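{- Let $a,b,m\in\mathbb{N}$. If $b\mid a$, then $$[q^n]\,F_{a,b,m}(q)\ge0\qquad\text{for all integers }0\le n<a+2m.$$
   Context: $\mathbb{N}$ is the set of positive integers. Notation: $(z;q)_\infty=\prod_{i\ge0}(1-zq^i)$; $[q^n]f$ denotes the coefficient of $q^n$ in the formal power series $f$. For $a,b,m\in\mathbb{N}$, $$F_{a,b,m}(q):=\frac{(-q^{a+b};q^m)_\infty}{(-q^a;q^m)_\infty\,(q^b;q^m)_\infty},$$ regarded as a formal power series in $q$. -}

module Defs where

open import Data.Fin.Base using (Fin; zero; suc; toℕ)
open import Data.Integer.Base as ℤ using (ℤ; 0ℤ; 1ℤ)
import Data.Integer.Properties as ℤₚ
open import Data.Nat.Base using (ℕ; zero; suc; _+_; _*_; _∸_; _≤_; _<_; NonZero; z≤n; s≤s; ≤′-refl; ≤′-step; _≤′_)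
import Data.Nat.Properties as ℕₚ
open import Data.Vec.Base using (Vec; []; _∷_; head; lookup)
open import Data.Bool.Base using (if_then_else_)
open import Relation.Binary.PropositionalEquality using (_≡_; _≢_; refl; sym; trans; cong; cong₂; module ≡-Reasoning)
open import Relation.Nullary.Decidable using (⌊_⌋; yes; no)
open import Relation.Nullary.Negation using (contradiction)

open import Algebra.Properties.CommutativeMonoid.Sum ℤₚ.+-0-commutativeMonoid
  using (sum⁺-syntax; sum-cong-≗; sum-replicate-zero)

-- A formal power series in q with integer coefficients is the function
-- sending n to the coefficient of q^n; so [q^n] f is  f n.
FPS : Set
FPS = ℕ → ℤ

infixl 7 _⊗_
infixl 6 _⊖_
infix  8 ⊝_

q^_ : ℕ → FPS
(q^ k) n = if ⌊ n ℕₚ.≟ k ⌋ then 1ℤ else 0ℤ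

one : FPS
one = q^ 0

⊝_ : FPS → FPS
(⊝ f) n = ℤ.- f n

_⊖_ : FPS → FPS → FPS
(f ⊖ g) n = f n ℤ.- g n

_⊗_ : FPS → FPS → FPS
(f ⊗ g) n = ∑[ i ≤ n ] (f (toℕ i) ℤ.* g (n ∸ toℕ i))

-- Reciprocal of a series g with constant term 1, from the recursion
--   r₀ = 1,   rₙ₊₁ = - ∑_{i ≤ n} gᵢ₊₁ rₙ₋ᵢ .
-- recips g n lists rₙ, …, r₀, in this order.  When g 0 is not 1 the result
-- is meaningless; see ⊗-recip.
recips : FPS → (n : ℕ) → Vec ℤ (suc n)
recips g zero    = 1ℤ ∷ []
recips g (suc n) =
  (ℤ.- (∑[ i ≤ n ] (g (suc (toℕ i)) ℤ.* lookup (recips g n) i))) ∷ recips g n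

recip : FPS → FPS
recip g n = head (recips g n)

infixl 7 _⊘_

_⊘_ : FPS → FPS → FPS
f ⊘ g = f ⊗ recip g

∏< : ℕ → (ℕ → FPS) → FPS
∏< zero    f = one
∏< (suc k) f = ∏< k f ⊗ f k

pochFactor : FPS → ℕ → ℕ → FPS
pochFactor z m i = one ⊖ z ⊗ q^ (m * i)

-- (z ; q^m)_∞ = ∏_{i ≥ 0} (1 - z q^{mi}) for m ≥ 1.  The factors with i > n
-- are 1 + O(q^{n+1}), so the coefficient of q^n in the infinite product is
-- the one in the product over i ≤ n; see poch-limit.
⟨_⨾q^_⟩∞ : FPS → ℕ → FPS
⟨ z ⨾q^ m ⟩∞ n = ∏< (suc n) (pochFactor z m) n

F : ℕ → ℕ → ℕ → FPS
F a b m = ⟨ ⊝ q^ (a + b) ⨾q^ m ⟩∞ ⊘ (⟨ ⊝ q^ a ⨾q^ m ⟩∞ ⊗ ⟨ q^ b ⨾q^ m ⟩∞)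

open ≡-Reasoning

q^-≢ : ∀ {k n} → n ≢ k → (q^ k) n ≡ 0ℤ
q^-≢ {k} {n} n≢k with n ℕₚ.≟ k
... | yes n≡k = contradiction n≡k n≢k
... | no  _   = refl

lookup-recips : ∀ g n (i : Fin (suc n)) → lookup (recips g n) i ≡ recip g (n ∸ toℕ i)
lookup-recips g zero    zero    = refl
lookup-recips g (suc n) zero    = refl
lookup-recips g (suc n) (suc i) = lookup-recips g n i

⊗-recip : ∀ g → g 0 ≡ 1ℤ → ∀ n → (g ⊗ recip g) n ≡ one n
⊗-recip g g₀≡1 zero    = trans (ℤₚ.+-identityʳ _) (trans (ℤₚ.*-identityʳ _) g₀≡1)
⊗-recip g g₀≡1 (suc n) = begin
  g 0 ℤ.* recip g (suc n) ℤ.+ S   ≡⟨ cong (λ x → x ℤ.* recip g (suc n) ℤ.+ S) g₀≡1 ⟩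
  1ℤ ℤ.* recip g (suc n) ℤ.+ S    ≡⟨ cong (ℤ._+ S) (ℤₚ.*-identityˡ (recip g (suc n))) ⟩
  recip g (suc n) ℤ.+ S           ≡⟨ cong (λ x → ℤ.- x ℤ.+ S) (sum-cong-≗ {suc n} λ i →
                                       cong (g (suc (toℕ i)) ℤ.*_) (lookup-recips g n i)) ⟩
  ℤ.- S ℤ.+ S                     ≡⟨ ℤₚ.+-inverseˡ S ⟩
  0ℤ                              ∎
  where S = ∑[ i ≤ n ] (g (suc (toℕ i)) ℤ.* recip g (n ∸ toℕ i))

⊗-q^-low : ∀ z {k} n → n < k → (z ⊗ q^ k) n ≡ 0ℤ
⊗-q^-low z {k} n n<k = trans
  (sum-cong-≗ {suc n} λ i → trans
    (cong (z (toℕ i) ℤ.*_)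
      (q^-≢ (ℕₚ.<⇒≢ (ℕₚ.≤-<-trans (ℕₚ.m∸n≤m n (toℕ i)) n<k))))
    (ℤₚ.*-zeroʳ (z (toℕ i))))
  (sum-replicate-zero (suc n))

⊗-identityʳ-upTo : ∀ f g n → (∀ {j} → j ≤ n → g j ≡ one j) → (f ⊗ g) n ≡ f n
⊗-identityʳ-upTo f g zero    g≈1 =
  trans (ℤₚ.+-identityʳ _) (trans (cong (f 0 ℤ.*_) (g≈1 z≤n)) (ℤₚ.*-identityʳ (f 0)))
⊗-identityʳ-upTo f g (suc n) g≈1 = trans
  (cong₂ ℤ._+_
    (trans (cong (f 0 ℤ.*_) (g≈1 ℕₚ.≤-refl)) (ℤₚ.*-zeroʳ (f 0)))
    (⊗-identityʳ-upTo (λ i → f (suc i)) g n (λ j≤n → g≈1 (ℕₚ.m≤n⇒m≤1+n j≤n))))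
  (ℤₚ.+-identityˡ (f (suc n)))

poch-limit : ∀ z m .{{_ : NonZero m}} n k → n < k →
             ∏< k (pochFactor z m) n ≡ ⟨ z ⨾q^ m ⟩∞ n
poch-limit z m n k n<k = go (ℕₚ.≤⇒≤′ n<k)
  where
  go : ∀ {k} → suc n ≤′ k → ∏< k (pochFactor z m) n ≡ ⟨ z ⨾q^ m ⟩∞ n
  go ≤′-refl               = refl
  go (≤′-step {k} n<k) = trans
    (⊗-identityʳ-upTo (∏< k (pochFactor z m)) (pochFactor z m k) n λ {j} j≤n →
      trans
        (cong (λ x → one j ℤ.- x)
          (⊗-q^-low z j (ℕₚ.<-≤-trans (s≤s j≤n)
            (ℕₚ.≤-trans (ℕₚ.≤′⇒≤ n<k) (ℕₚ.m≤n*m k m)))))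
        (ℤₚ.+-identityʳ (one j)))
    (go n<k)

poch-constant : ∀ z m → z 0 ≡ 0ℤ → ⟨ z ⨾q^ m ⟩∞ 0 ≡ 1ℤ
poch-constant z m z₀≡0 = begin
  1ℤ ℤ.* (1ℤ ℤ.- (z 0 ℤ.* c ℤ.+ 0ℤ)) ℤ.+ 0ℤ
    ≡⟨ cong (λ x → 1ℤ ℤ.* (1ℤ ℤ.- (x ℤ.* c ℤ.+ 0ℤ)) ℤ.+ 0ℤ) z₀≡0 ⟩
  1ℤ ∎
  where c = (q^ (m * 0)) 0

F-denominator-constant : ∀ a b m .{{_ : NonZero a}} .{{_ : NonZero b}} →
  (⟨ ⊝ q^ a ⨾q^ m ⟩∞ ⊗ ⟨ q^ b ⨾q^ m ⟩∞) 0 ≡ 1ℤ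
F-denominator-constant (suc a) (suc b) m = cong₂ (λ x y → x ℤ.* y ℤ.+ 0ℤ)
  (poch-constant (⊝ q^ (suc a)) m refl) (poch-constant (q^ (suc b)) m refl)

{-# OPTIONS --safe #-}

-- Put x = q^a, y = q^b, Q = q^m and work modulo q^(a+2m), so that x Q² = 0 and
--   F = (1+xy)(1+xyQ) / ((1+x)(1+xQ)(y;Q)_∞) = W (1/(yQ;Q)_∞ - xQ(1-y)),
--   W = (1+xy) / ((1+x)(1-y)).
-- Since 1/(yQ;Q)_∞ dominates 1 + yQ coefficientwise, it is enough that W and
-- W (y - x + xy) are nonnegative.  As b ∣ a, 1 - y divides 1 - x; writing
-- (1-x)/(1-y) = 1 + T with T ≥ 0 and clearing 1 - x² they become
--   (1-x²) W = 1 + T + xT + x²,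
--   (1-x²) W (y - x + xy) = T + xyT + x² + x³y.

module Submission where

open import Algebra.Bundles using (CommutativeRing)
import Algebra.Solver.Ring as RingSolver
open import Algebra.Solver.Ring.AlmostCommutativeRing
  using (fromCommutativeRing; _-Raw-AlmostCommutative⟶_)
open import Data.Bool.Base using (if_then_else_; true; false)
open import Data.Fin.Base using (toℕ)
open import Data.Fin.Properties using (toℕ<n)
open import Data.Integer.Base as ℤ using (ℤ; 0ℤ; 1ℤ)
import Data.Integer.Properties as ℤₚ
open import Algebra.Properties.CommutativeMonoid.Sum ℤₚ.+-0-commutativeMonoid using (sum-cong-≗)
open import Data.Integer.Tactic.RingSolver using (solve-∀)
open import Data.Maybe.Base using (map)
open import Data.Nat.Base as ℕ using (ℕ; zero; suc; _≤_; _<_; NonZero; z≤n)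
open import Data.Nat.Divisibility using (_∣_; divides)
import Data.Nat.Properties as ℕₚ
open import Data.Product.Base using (∃-syntax; _×_; _,_)
open import Defs
open import Function.Base using (_∘_)
open import Level using (Level; _⊔_; 0ℓ) renaming (suc to lsuc)
open import Relation.Binary.Bundles using (Setoid)
open import Relation.Binary.PropositionalEquality
  using (_≡_; _≗_; cong; cong₂; subst; module ≡-Reasoning)
  renaming (refl to ≡-refl; sym to ≡-sym; trans to ≡-trans)
open import Relation.Nullary.Decidable using (⌊_⌋; dec⇒maybe; isYes≗does)
open import Relation.Nullary.Negation using (contradiction)

-- Ring laws for the Cauchy product.

infixl 6 _⊕_
infixl 8 _·_

_⊕_ : FPS → FPS → FPS
(f ⊕ g) n = f n ℤ.+ g n

_·_ : ℤ → FPS → FPS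
(c · f) n = c ℤ.* f n

𝟘 : FPS
𝟘 _ = 0ℤ

⊗-distribʳ : ∀ h f g → ((f ⊕ g) ⊗ h) ≗ ((f ⊗ h) ⊕ (g ⊗ h))
⊗-distribʳ h f g zero = lemma (f 0) (g 0) (h 0)
  where
  lemma : ∀ a b c → (a ℤ.+ b) ℤ.* c ℤ.+ 0ℤ ≡ (a ℤ.* c ℤ.+ 0ℤ) ℤ.+ (b ℤ.* c ℤ.+ 0ℤ)
  lemma = solve-∀
⊗-distribʳ h f g (suc n) =
  ≡-trans (cong (λ s → (f 0 ℤ.+ g 0) ℤ.* h (suc n) ℤ.+ s) (⊗-distribʳ h (f ∘ suc) (g ∘ suc) n))
    (lemma (f 0) (g 0) (h (suc n)) _ _)
  where
  lemma : ∀ a b c p q → (a ℤ.+ b) ℤ.* c ℤ.+ (p ℤ.+ q) ≡ (a ℤ.* c ℤ.+ p) ℤ.+ (b ℤ.* c ℤ.+ q)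
  lemma = solve-∀

·-⊗-assoc : ∀ c f g → ((c · f) ⊗ g) ≗ (c · (f ⊗ g))
·-⊗-assoc c f g zero = lemma c (f 0) (g 0)
  where
  lemma : ∀ c a b → c ℤ.* a ℤ.* b ℤ.+ 0ℤ ≡ c ℤ.* (a ℤ.* b ℤ.+ 0ℤ)
  lemma = solve-∀
·-⊗-assoc c f g (suc n) =
  ≡-trans (cong (λ s → c ℤ.* f 0 ℤ.* g (suc n) ℤ.+ s) (·-⊗-assoc c (f ∘ suc) g n))
    (lemma c (f 0) (g (suc n)) _)
  where
  lemma : ∀ c a b p → c ℤ.* a ℤ.* b ℤ.+ c ℤ.* p ≡ c ℤ.* (a ℤ.* b ℤ.+ p)
  lemma = solve-∀

⊗-assoc : ∀ f g h → ((f ⊗ g) ⊗ h) ≗ (f ⊗ (g ⊗ h))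
⊗-assoc f g h zero = lemma (f 0) (g 0) (h 0)
  where
  lemma : ∀ a b c → (a ℤ.* b ℤ.+ 0ℤ) ℤ.* c ℤ.+ 0ℤ ≡ a ℤ.* (b ℤ.* c ℤ.+ 0ℤ) ℤ.+ 0ℤ
  lemma = solve-∀
⊗-assoc f g h (suc n) = begin
  -- By computation, `(f ⊗ g) ∘ suc` is `f 0 · (g ∘ suc) ⊕ (f ∘ suc) ⊗ g`, so the induction
  -- hypothesis is applied to the shifted series `f ∘ suc`.
  (f 0 ℤ.* g 0 ℤ.+ 0ℤ) ℤ.* h (suc n) ℤ.+ ((f 0 · (g ∘ suc) ⊕ (f ∘ suc) ⊗ g) ⊗ h) n
    ≡⟨ cong (λ s → (f 0 ℤ.* g 0 ℤ.+ 0ℤ) ℤ.* h (suc n) ℤ.+ s)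
         (⊗-distribʳ h (f 0 · (g ∘ suc)) ((f ∘ suc) ⊗ g) n) ⟩
  (f 0 ℤ.* g 0 ℤ.+ 0ℤ) ℤ.* h (suc n) ℤ.+ ((f 0 · (g ∘ suc) ⊗ h) n ℤ.+ ((f ∘ suc) ⊗ g ⊗ h) n)
    ≡⟨ cong₂ (λ s t → (f 0 ℤ.* g 0 ℤ.+ 0ℤ) ℤ.* h (suc n) ℤ.+ (s ℤ.+ t))
         (·-⊗-assoc (f 0) (g ∘ suc) h n) (⊗-assoc (f ∘ suc) g h n) ⟩
  (f 0 ℤ.* g 0 ℤ.+ 0ℤ) ℤ.* h (suc n) ℤ.+ (f 0 ℤ.* ((g ∘ suc) ⊗ h) n ℤ.+ ((f ∘ suc) ⊗ (g ⊗ h)) n)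
    ≡⟨ lemma (f 0) (g 0) (h (suc n)) _ _ ⟩
  f 0 ℤ.* (g 0 ℤ.* h (suc n) ℤ.+ ((g ∘ suc) ⊗ h) n) ℤ.+ ((f ∘ suc) ⊗ (g ⊗ h)) n ∎
  where
  open ≡-Reasoning
  lemma : ∀ a b c p q → (a ℤ.* b ℤ.+ 0ℤ) ℤ.* c ℤ.+ (a ℤ.* p ℤ.+ q) ≡ a ℤ.* (b ℤ.* c ℤ.+ p) ℤ.+ q
  lemma = solve-∀

-- The definition of `_⊗_` peels off `f 0`; peeling off `g 0` instead is the mirror image that
-- commutativity needs in its inductive step.
⊗-sucʳ : ∀ f g n → (f ⊗ g) (suc n) ≡ g 0 ℤ.* f (suc n) ℤ.+ (f ⊗ (g ∘ suc)) n
⊗-sucʳ f g zero = lemma (f 0) (g 1) (f 1) (g 0)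
  where
  lemma : ∀ a b c d → a ℤ.* b ℤ.+ (c ℤ.* d ℤ.+ 0ℤ) ≡ d ℤ.* c ℤ.+ (a ℤ.* b ℤ.+ 0ℤ)
  lemma = solve-∀
⊗-sucʳ f g (suc n) =
  ≡-trans (cong (λ s → f 0 ℤ.* g (suc (suc n)) ℤ.+ s) (⊗-sucʳ (f ∘ suc) g n))
    (lemma (f 0 ℤ.* g (suc (suc n))) (g 0 ℤ.* f (suc (suc n))) _)
  where
  lemma : ∀ a b c → a ℤ.+ (b ℤ.+ c) ≡ b ℤ.+ (a ℤ.+ c)
  lemma = solve-∀

⊗-comm : ∀ f g → (f ⊗ g) ≗ (g ⊗ f)
⊗-comm f g zero    = cong (ℤ._+ 0ℤ) (ℤₚ.*-comm (f 0) (g 0))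
⊗-comm f g (suc n) =
  ≡-trans (cong (λ s → f 0 ℤ.* g (suc n) ℤ.+ s) (⊗-comm (f ∘ suc) g n)) (≡-sym (⊗-sucʳ g f n))

⊗-zeroˡ : ∀ f → (𝟘 ⊗ f) ≗ 𝟘
⊗-zeroˡ f zero    = ≡-refl
⊗-zeroˡ f (suc n) = ≡-trans (ℤₚ.+-identityˡ _) (⊗-zeroˡ f n)

⊗-identityˡ : ∀ f → (one ⊗ f) ≗ f
⊗-identityˡ f zero    = ≡-trans (ℤₚ.+-identityʳ _) (ℤₚ.*-identityˡ (f 0))
⊗-identityˡ f (suc n) =
  ≡-trans (cong₂ ℤ._+_ (ℤₚ.*-identityˡ (f (suc n))) (⊗-zeroˡ f n)) (ℤₚ.+-identityʳ (f (suc n)))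

-- Only indices up to `n` enter the coefficient of q^n, which makes `_⊗_` compatible with congruence
-- modulo q^N.
⊗-cong-upTo : ∀ {f f′ g g′ : FPS} n → (∀ {j} → j ≤ n → f j ≡ f′ j) →
              (∀ {j} → j ≤ n → g j ≡ g′ j) → (f ⊗ g) n ≡ (f′ ⊗ g′) n
⊗-cong-upTo n f≡f′ g≡g′ = sum-cong-≗ {suc n} λ i →
  cong₂ ℤ._*_ (f≡f′ (ℕₚ.≤-pred (toℕ<n i))) (g≡g′ (ℕₚ.m∸n≤m n (toℕ i)))

⊗-cong : ∀ {f f′ g g′ : FPS} → f ≗ f′ → g ≗ g′ → (f ⊗ g) ≗ (f′ ⊗ g′)
⊗-cong f≗f′ g≗g′ n = ⊗-cong-upTo n (λ {j} _ → f≗f′ j) (λ {j} _ → g≗g′ j)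

-- The two decisions carry different proofs but have definitionally equal `does`, so the comparison
-- passes through `does`.
q^-suc : ∀ k n → (q^ suc k) (suc n) ≡ (q^ k) n
q^-suc k n = cong (if_then 1ℤ else 0ℤ)
  (≡-trans (isYes≗does (suc n ℕₚ.≟ suc k)) (≡-sym (isYes≗does (n ℕₚ.≟ k))))

q^-⊗-q^ : ∀ j k → (q^ j ⊗ q^ k) ≗ (q^ (j ℕ.+ k))
q^-⊗-q^ zero    k n       = ⊗-identityˡ (q^ k) n
q^-⊗-q^ (suc j) k zero    = ≡-refl
q^-⊗-q^ (suc j) k (suc n) = begin
  0ℤ ℤ.+ ((q^ suc j ∘ suc) ⊗ q^ k) n  ≡⟨ ℤₚ.+-identityˡ _ ⟩
  ((q^ suc j ∘ suc) ⊗ q^ k) n         ≡⟨ ⊗-cong {g = q^ k} (q^-suc j) (λ _ → ≡-refl) n ⟩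
  (q^ j ⊗ q^ k) n                     ≡⟨ q^-⊗-q^ j k n ⟩
  (q^ (j ℕ.+ k)) n                    ≡⟨ q^-suc (j ℕ.+ k) n ⟨
  (q^ (suc j ℕ.+ k)) (suc n)          ∎
  where open ≡-Reasoning

-- Coefficientwise nonnegativity.

NonNegative : FPS → Set
NonNegative f = ∀ n → 0ℤ ℤ.≤ f n

⊕-nonNegative : ∀ {f g} → NonNegative f → NonNegative g → NonNegative (f ⊕ g)
⊕-nonNegative 0≤f 0≤g n = ℤₚ.+-mono-≤ (0≤f n) (0≤g n)

⊗-nonNegative : ∀ {f g} → NonNegative f → NonNegative g → NonNegative (f ⊗ g)
⊗-nonNegative {f} {g} 0≤f 0≤g = λ where
    zero    → ℤₚ.+-mono-≤ (*-nonNegative 0) ℤₚ.≤-refl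
    (suc n) → ℤₚ.+-mono-≤ (*-nonNegative (suc n)) (⊗-nonNegative (0≤f ∘ suc) 0≤g n)
  where
  *-nonNegative : ∀ n → 0ℤ ℤ.≤ f 0 ℤ.* g n
  *-nonNegative n = ℤₚ.*-monoʳ-≤-nonNeg (g n) {{ℤ.nonNegative (0≤g n)}} (0≤f 0)

q^-nonNegative : ∀ k → NonNegative (q^ k)
q^-nonNegative k n with ⌊ n ℕₚ.≟ k ⌋
... | true  = ℤ.+≤+ z≤n
... | false = ℤₚ.≤-refl

-- The commutative ring of power series modulo q^N.

const : ℤ → FPS
const c zero    = c
const c (suc _) = 0ℤ

-- A record rather than a bare function type, so that `f` and `g` can be inferred from the type of a
-- proof.
record _≈_mod-q^_ (f g : FPS) (N : ℕ) : Set where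
  constructor agree
  field coeff : ∀ {n} → n < N → f n ≡ g n
open _≈_mod-q^_ public

-- X k plays the role of q^k modulo q^N, and P that of coefficientwise nonnegativity.
record PositiveMonomials {c ℓ} (R : CommutativeRing c ℓ) (p : Level) (N : ℕ) : Set (c ⊔ ℓ ⊔ lsuc p) where
  open CommutativeRing R
  field
    X      : ℕ → Carrier
    X-0    : X 0 ≈ 1#
    X-+    : ∀ j k → X j * X k ≈ X (j ℕ.+ k)
    X-high : ∀ {k} → N ≤ k → X k ≈ 0#
    P      : Carrier → Set p
    P-0    : P 0#
    P-1    : P 1#
    P-X    : ∀ k → P (X k)
    P-+    : ∀ {f g} → P f → P g → P (f + g)
    P-*    : ∀ {f g} → P f → P g → P (f * g)

module Truncated (N : ℕ) where

  infix 4 _≈_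
  _≈_ : FPS → FPS → Set
  f ≈ g = f ≈ g mod-q^ N

  ≗⇒≈ : ∀ {f g} → f ≗ g → f ≈ g
  ≗⇒≈ f≗g = agree λ {n} _ → f≗g n

  commutativeRing : CommutativeRing _ _
  commutativeRing = record
    { Carrier = FPS
    ; _≈_ = _≈_
    ; _+_ = _⊕_
    ; _*_ = _⊗_
    ; -_  = ⊝_
    ; 0#  = 𝟘
    ; 1#  = one
    ; isCommutativeRing = record
      { isRing = record
        { +-isAbelianGroup = record
          { isGroup = record
            { isMonoid = record
              { isSemigroup = record
                { isMagma = record
                  { isEquivalence = Setoid.isEquivalence truncatedSetoid
                  ; ∙-cong = ⊕-cong-mod
                  }
                ; assoc = λ f g h → ≗⇒≈ λ n → ℤₚ.+-assoc (f n) (g n) (h n)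
                }
              ; identity = comm∧idˡ⇒id ⊕-comm λ f → ≗⇒≈ λ n → ℤₚ.+-identityˡ (f n)
              }
            ; inverse = comm∧invˡ⇒inv ⊕-comm λ f → ≗⇒≈ λ n → ℤₚ.+-inverseˡ (f n)
            ; ⁻¹-cong = λ f≈g → agree λ n<N → cong ℤ.-_ (coeff f≈g n<N)
            }
          ; comm = ⊕-comm
          }
        ; *-cong = ⊗-cong-mod
        ; *-assoc = λ f g h → ≗⇒≈ (⊗-assoc f g h)
        ; *-identity = comm∧idˡ⇒id ⊗-comm-mod λ f → ≗⇒≈ (⊗-identityˡ f)
        ; distrib = comm∧distrʳ⇒distr ⊕-cong-mod ⊗-comm-mod λ h f g → ≗⇒≈ (⊗-distribʳ h f g)
        }
      ; *-comm = ⊗-comm-mod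
      }
    }
    where
    truncatedSetoid : Setoid _ _
    truncatedSetoid = record
      { _≈_ = _≈_
      ; isEquivalence = record
        { refl  = agree λ _ → ≡-refl
        ; sym   = λ f≈g → agree λ n<N → ≡-sym (coeff f≈g n<N)
        ; trans = λ f≈g g≈h → agree λ n<N → ≡-trans (coeff f≈g n<N) (coeff g≈h n<N)
        }
      }
    open import Algebra.Consequences.Setoid truncatedSetoid
      using (comm∧idˡ⇒id; comm∧invˡ⇒inv; comm∧distrʳ⇒distr)
    ⊕-comm : ∀ f g → (f ⊕ g) ≈ (g ⊕ f)
    ⊕-comm f g = ≗⇒≈ λ n → ℤₚ.+-comm (f n) (g n)
    ⊗-comm-mod : ∀ f g → (f ⊗ g) ≈ (g ⊗ f)
    ⊗-comm-mod f g = ≗⇒≈ (⊗-comm f g)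
    ⊕-cong-mod : ∀ {f f′ g g′} → f ≈ f′ → g ≈ g′ → (f ⊕ g) ≈ (f′ ⊕ g′)
    ⊕-cong-mod f≈f′ g≈g′ = agree λ n<N → cong₂ ℤ._+_ (coeff f≈f′ n<N) (coeff g≈g′ n<N)
    ⊗-cong-mod : ∀ {f f′ g g′} → f ≈ f′ → g ≈ g′ → (f ⊗ g) ≈ (f′ ⊗ g′)
    ⊗-cong-mod f≈f′ g≈g′ = agree λ {n} n<N → ⊗-cong-upTo n
      (λ j≤n → coeff f≈f′ (ℕₚ.≤-<-trans j≤n n<N))
      (λ j≤n → coeff g≈g′ (ℕₚ.≤-<-trans j≤n n<N))

  const-morphism : CommutativeRing.rawRing ℤₚ.+-*-commutativeRing
                   -Raw-AlmostCommutative⟶ fromCommutativeRing commutativeRing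
  const-morphism = record
    { ⟦_⟧    = const
    ; +-homo = λ c d → ≗⇒≈ λ { zero → ≡-refl ; (suc _) → ≡-refl }
    ; *-homo = λ c d → ≗⇒≈ λ
        { zero    → ≡-sym (ℤₚ.+-identityʳ _)
        ; (suc n) → ≡-sym (cong₂ ℤ._+_ (ℤₚ.*-zeroʳ c) (⊗-zeroˡ (const d) n))
        }
    ; -‿homo = λ c → ≗⇒≈ λ { zero → ≡-refl ; (suc _) → ≡-refl }
    ; 0-homo = ≗⇒≈ λ { zero → ≡-refl ; (suc _) → ≡-refl }
    ; 1-homo = ≗⇒≈ λ { zero → ≡-refl ; (suc _) → ≡-refl }
    }

  nonNegativeMonomials : PositiveMonomials commutativeRing 0ℓ N
  nonNegativeMonomials = record
    { X      = q^_
    ; X-0    = ≗⇒≈ λ _ → ≡-refl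
    ; X-+    = λ j k → ≗⇒≈ (q^-⊗-q^ j k)
    ; X-high = λ N≤k → agree λ n<N → q^-≢ (ℕₚ.<⇒≢ (ℕₚ.<-≤-trans n<N N≤k))
    ; P      = NonNegative
    ; P-0    = λ _ → ℤₚ.≤-refl
    ; P-1    = q^-nonNegative 0
    ; P-X    = q^-nonNegative
    ; P-+    = ⊕-nonNegative
    ; P-*    = ⊗-nonNegative
    }

-- The algebraic identities behind the positive form of the quotient.

-- ι lets the ring solver compute with integer coefficients.
module Certificate {c ℓ} (R : CommutativeRing c ℓ)
  (ι : CommutativeRing.rawRing ℤₚ.+-*-commutativeRing -Raw-AlmostCommutative⟶ fromCommutativeRing R) where

  open CommutativeRing R
  open _-Raw-AlmostCommutative⟶_ ι using (⟦_⟧)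
  open RingSolver _ _ ι (λ i j → map (λ i≡j → reflexive (cong ⟦_⟧ i≡j)) (dec⇒maybe (i ℤₚ.≟ j)))
  open import Relation.Binary.Reasoning.Setoid setoid

  private
    -- Unlike con 1ℤ, which denotes ⟦ 1ℤ ⟧, this denotes 1# definitionally.
    :1 : ∀ {n} → Polynomial n
    :1 = con 0ℤ :^ 0

  -- Reduces a claim about the quotient `p * r` to one cleared of its denominator `d`.
  *-inverse-unique : ∀ {d r p f} → d * r ≈ 1# → f * d ≈ p → p * r ≈ f
  *-inverse-unique {d} {r} {p} {f} dr≈1 fd≈p = begin
    p * r        ≈⟨ *-congʳ fd≈p ⟨
    f * d * r    ≈⟨ *-assoc f d r ⟩
    f * (d * r)  ≈⟨ *-congˡ dr≈1 ⟩
    f * 1#       ≈⟨ *-identityʳ f ⟩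
    f            ∎

  -- `A` and `B` are `(1-x²) W` and `(1-x²) W (y - x + xy)`, in the forms free of subtraction.
  A : Carrier → Carrier → Carrier
  A x T = 1# + T + x * T + x * x

  B : Carrier → Carrier → Carrier → Carrier
  B x y T = T + x * y * T + x * x + x * x * x * y

  -- This is `(1-x²) F` without subtraction. Expand `1/(yQ;Q)_∞ = u (1 + M)` as
  -- `1 + yQ + (yQ)² u + u M`: the `1` contributes `A`, the `yQ` absorbs the negative term
  -- `-xQ(1-y)` and yields `Q B`, and the rest is multiplied by `A`.
  K : (x y Q T u M : Carrier) → Carrier
  K x y Q T u M = A x T + Q * B x y T + A x T * (y * Q * (y * Q) * u + u * M)

  -- The intended values are g = 1/(1-x²), u = 1/(1-yQ), E = (yQ²;Q)_∞ and
  -- 1 + M = 1/E; then F = g K.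
  module _ {x y Q T g u M E : Carrier}
    (yS≈T+x : y * (1# + T) ≈ T + x)
    (g-inv  : (1# - x * x) * g ≈ 1#)
    (u-inv  : (1# - y * Q) * u ≈ 1#)
    (E-inv  : E * (1# + M) ≈ 1#)
    (xQQ≈0  : x * Q * Q ≈ 0#)
    (xQE≈xQ : x * Q * E ≈ x * Q) where

    private
      A₀ B₀ K₀ : Carrier
      A₀ = A x T
      B₀ = B x y T
      K₀ = K x y Q T u M

      -- F = g A₀ V.
      V : Carrier
      V = u * (1# + M) - x * Q * (1# - y)

    -- The relation `yS≈T+x` says `(1-y)(1+T) = 1-x`, and `A₀ = (1+x)(1+T) - x(1-x)`; hence `1-x`
    -- comes out after multiplying by `1-y`.
    A-factor : A₀ * (1# - y) ≈ (1# + x * y) * (1# - x)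
    A-factor = begin
      A₀ * (1# - y)
        -- The solver knows only polynomial identities, so the multiple of `yS≈T+x` by `1+x` is
        -- written out and then cancelled.
        ≈⟨ solve 3 (λ x y T →
             (:1 :+ T :+ x :* T :+ x :* x) :* (:1 :- y) :=
             (:1 :+ x :* y) :* (:1 :- x) :+ (:1 :+ x) :* (T :+ x) :- (:1 :+ x) :* (y :* (:1 :+ T)))
             refl x y T ⟩
      (1# + x * y) * (1# - x) + (1# + x) * (T + x) - (1# + x) * (y * (1# + T))
        ≈⟨ +-congˡ (-‿cong (*-congˡ yS≈T+x)) ⟩
      (1# + x * y) * (1# - x) + (1# + x) * (T + x) - (1# + x) * (T + x)
        ≈⟨ solve 2 (λ p q → p :+ q :- q := p) refl _ _ ⟩
      (1# + x * y) * (1# - x) ∎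

    B-factor : B₀ ≈ A₀ * (y - x + x * y)
    B-factor = begin
      B₀
        ≈⟨ solve 2 (λ p q → p := p :+ q :- q) refl B₀ _ ⟩
      -- The cofactor comes from collecting `y(1+T)`: `A₀ (y - x + xy)` contains `(1+x)² y(1+T)` and
      -- a term `-xy`, which is `xyT - x y(1+T)`.
      B₀ + (x - (1# + x) * (1# + x)) * (T + x) - (x - (1# + x) * (1# + x)) * (T + x)
        ≈⟨ +-congˡ (-‿cong (*-congˡ yS≈T+x)) ⟨
      B₀ + (x - (1# + x) * (1# + x)) * (T + x) - (x - (1# + x) * (1# + x)) * (y * (1# + T))
        ≈⟨ solve 3 (λ x y T →
             T :+ x :* y :* T :+ x :* x :+ x :* x :* x :* y
               :+ (x :- (:1 :+ x) :* (:1 :+ x)) :* (T :+ x)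
               :- (x :- (:1 :+ x) :* (:1 :+ x)) :* (y :* (:1 :+ T)) :=
             (:1 :+ T :+ x :* T :+ x :* x) :* (y :- x :+ x :* y)) refl x y T ⟩
      A₀ * (y - x + x * y) ∎

    -- Two terms of the geometric series are split off, because `yQ` is the one that must offset
    -- `-xQ(1-y)`.
    u-expand : u ≈ 1# + y * Q + y * Q * (y * Q) * u
    u-expand = begin
      u
        ≈⟨ solve 2 (λ u z → u := (:1 :+ z) :* ((:1 :- z) :* u) :+ z :* z :* u) refl u (y * Q) ⟩
      (1# + y * Q) * ((1# - y * Q) * u) + y * Q * (y * Q) * u
        ≈⟨ +-congʳ (trans (*-congˡ u-inv) (*-identityʳ _)) ⟩
      1# + y * Q + y * Q * (y * Q) * u ∎

    K-factor : K₀ ≈ A₀ * V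
    K-factor = begin
      A₀ + Q * B₀ + A₀ * (y * Q * (y * Q) * u + u * M)
        ≈⟨ +-congʳ (+-congˡ (*-congˡ B-factor)) ⟩
      A₀ + Q * (A₀ * (y - x + x * y)) + A₀ * (y * Q * (y * Q) * u + u * M)
        ≈⟨ solve 6 (λ A₀ x y Q u M →
             A₀ :+ Q :* (A₀ :* (y :- x :+ x :* y)) :+ A₀ :* (y :* Q :* (y :* Q) :* u :+ u :* M) :=
             A₀ :* ((:1 :+ y :* Q :+ y :* Q :* (y :* Q) :* u) :+ u :* M :- x :* Q :* (:1 :- y)))
             refl A₀ x y Q u M ⟩
      A₀ * ((1# + y * Q + y * Q * (y * Q) * u) + u * M - x * Q * (1# - y))
        ≈⟨ *-congˡ (+-congʳ (+-congʳ u-expand)) ⟨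
      A₀ * (u + u * M - x * Q * (1# - y))
        ≈⟨ solve 4 (λ A₀ u M v →
             A₀ :* (u :+ u :* M :- v) := A₀ :* (u :* (:1 :+ M) :- v)) refl A₀ u M (x * Q * (1# - y)) ⟩
      A₀ * V ∎

    -- So `g * A₀` is `W`: the factor `1-x` from `A-factor` completes `1+x` to `1-x²`, which `g`
    -- cancels.
    gA-factor : g * A₀ * ((1# + x) * (1# - y)) ≈ 1# + x * y
    gA-factor = begin
      g * A₀ * ((1# + x) * (1# - y))
        ≈⟨ solve 4 (λ g A₀ x y → g :* A₀ :* ((:1 :+ x) :* (:1 :- y)) :=
             g :* (:1 :+ x) :* (A₀ :* (:1 :- y))) refl g A₀ x y ⟩
      g * (1# + x) * (A₀ * (1# - y))
        ≈⟨ *-congˡ A-factor ⟩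
      g * (1# + x) * ((1# + x * y) * (1# - x))
        ≈⟨ solve 3 (λ g x y → g :* (:1 :+ x) :* ((:1 :+ x :* y) :* (:1 :- x)) :=
             (:1 :+ x :* y) :* ((:1 :- x :* x) :* g)) refl g x y ⟩
      (1# + x * y) * ((1# - x * x) * g)
        ≈⟨ trans (*-congˡ g-inv) (*-identityʳ _) ⟩
      1# + x * y ∎

    -- The product `(1-yQ) E` cancels `u (1 + M)`, and `E` disappears next to `xQ`. What remains
    -- differs from `1 + xyQ` by a multiple of `xQ²`, which is zero.
    V-factor : V * ((1# + x * Q) * ((1# - y * Q) * E)) ≈ 1# + x * y * Q
    V-factor = begin
      V * ((1# + x * Q) * ((1# - y * Q) * E))
        ≈⟨ solve 6 (λ x y Q u M E →
             (u :* (:1 :+ M) :- x :* Q :* (:1 :- y)) :* ((:1 :+ x :* Q) :* ((:1 :- y :* Q) :* E)) :=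
             (:1 :+ x :* Q) :* (((:1 :- y :* Q) :* u) :* (E :* (:1 :+ M))
               :- (:1 :- y) :* (:1 :- y :* Q) :* (x :* Q :* E))) refl x y Q u M E ⟩
      (1# + x * Q) * (((1# - y * Q) * u) * (E * (1# + M)) - (1# - y) * (1# - y * Q) * (x * Q * E))
        ≈⟨ *-congˡ (+-cong (*-cong u-inv E-inv) (-‿cong (*-congˡ xQE≈xQ))) ⟩
      (1# + x * Q) * (1# * 1# - (1# - y) * (1# - y * Q) * (x * Q))
        ≈⟨ *-congˡ (+-congʳ (*-identityʳ 1#)) ⟩
      (1# + x * Q) * (1# - (1# - y) * (1# - y * Q) * (x * Q))
        ≈⟨ solve 3 (λ x y Q →
             (:1 :+ x :* Q) :* (:1 :- (:1 :- y) :* (:1 :- y :* Q) :* (x :* Q)) :=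
             :1 :+ x :* y :* Q :+ (y :* (:1 :- y) :* (:1 :+ x :* Q) :- x :* (:1 :- y)) :* (x :* Q :* Q))
             refl x y Q ⟩
      1# + x * y * Q + (y * (1# - y) * (1# + x * Q) - x * (1# - y)) * (x * Q * Q)
        ≈⟨ +-congˡ (trans (*-congˡ xQQ≈0) (zeroʳ _)) ⟩
      1# + x * y * Q + 0#
        ≈⟨ +-identityʳ _ ⟩
      1# + x * y * Q ∎

    -- The factors of `d` are dealt out to `W` and `V`: `(1+x)(1-y)` clears `g * A₀`, and
    -- `(1+xQ)(1-yQ) E` clears `V`.
    quotient : ∀ {d p r} → d * r ≈ 1# →
      d ≈ ((1# + x) * (1# + x * Q)) * ((1# - y) * (1# - y * Q) * E) →
      p ≈ (1# + x * y) * (1# + x * y * Q) →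
      p * r ≈ g * K₀
    quotient {d} {p} dr≈1 d≈ p≈ = *-inverse-unique dr≈1 (begin
      g * K₀ * d
        ≈⟨ *-cong (*-congˡ K-factor) d≈ ⟩
      g * (A₀ * V) * (((1# + x) * (1# + x * Q)) * ((1# - y) * (1# - y * Q) * E))
        ≈⟨ solve 8 (λ g A₀ V p q r s E →
             g :* (A₀ :* V) :* ((p :* q) :* (r :* s :* E)) :=
             (g :* A₀ :* (p :* r)) :* (V :* (q :* (s :* E)))) refl g A₀ V _ _ _ _ E ⟩
      (g * A₀ * ((1# + x) * (1# - y))) * (V * ((1# + x * Q) * ((1# - y * Q) * E)))
        ≈⟨ *-cong gA-factor V-factor ⟩
      (1# + x * y) * (1# + x * y * Q)
        ≈⟨ p≈ ⟨
      p ∎)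

-- Truncated geometric series.

module TruncatedProducts {c ℓ p N} (R : CommutativeRing c ℓ)
  (ι : CommutativeRing.rawRing ℤₚ.+-*-commutativeRing -Raw-AlmostCommutative⟶ fromCommutativeRing R)
  (positiveMonomials : PositiveMonomials R p N) where

  open CommutativeRing R
  open PositiveMonomials positiveMonomials
  open Certificate R ι
  open import Algebra.Properties.CommutativeSemigroup *-commutativeSemigroup using (interchange)
  open import Algebra.Properties.Ring ring using (-‿distribˡ-*; -‿distribʳ-*; -‿involutive; -0#≈0#)
  open import Relation.Binary.Reasoning.Setoid setoid

  -- Horner form of a geometric sum with `k` terms. With `suc N` terms it inverts `1 - X e`; with
  -- `a / b` terms and `e = b` it is the polynomial `(1-q^a)/(1-q^b)`.
  geom : ℕ → ℕ → Carrier
  geom e zero    = 0#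
  geom e (suc k) = 1# + X e * geom e k

  P-geom : ∀ e k → P (geom e k)
  P-geom e zero    = P-0
  P-geom e (suc k) = P-+ P-1 (P-* (P-X e) (P-geom e k))

  X-cong : ∀ {j k} → j ≡ k → X j ≈ X k
  X-cong j≡k = reflexive (cong X j≡k)

  1-0≈1 : ∀ {f} → f ≈ 0# → 1# - f ≈ 1#
  1-0≈1 f≈0 = trans (+-congˡ (trans (-‿cong f≈0) -0#≈0#)) (+-identityʳ 1#)

  -- Splits off the top term. That term vanishes in `geom-inverse`, and it is `X a` in the relation
  -- `yS≈T+x`.
  X-*-geom : ∀ e k → X e * geom e (suc k) ≈ X e * geom e k + X (suc k ℕ.* e)
  X-*-geom e zero    = begin
    X e * (1# + X e * 0#)   ≈⟨ *-congˡ (trans (+-congˡ (zeroʳ _)) (+-identityʳ 1#)) ⟩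
    X e * 1#                ≈⟨ *-identityʳ _ ⟩
    X e                     ≈⟨ X-cong (≡-sym (ℕₚ.+-identityʳ e)) ⟩
    X (1 ℕ.* e)             ≈⟨ +-identityˡ _ ⟨
    0# + X (1 ℕ.* e)        ≈⟨ +-congʳ (zeroʳ _) ⟨
    X e * 0# + X (1 ℕ.* e)  ∎
  X-*-geom e (suc k) = begin
    X e * (1# + X e * geom e (suc k))
      ≈⟨ *-congˡ (+-congˡ (X-*-geom e k)) ⟩
    X e * (1# + (X e * geom e k + X (suc k ℕ.* e)))
      ≈⟨ *-congˡ (+-assoc 1# _ _) ⟨
    X e * (geom e (suc k) + X (suc k ℕ.* e))
      ≈⟨ distribˡ _ _ _ ⟩
    X e * geom e (suc k) + X e * X (suc k ℕ.* e)
      ≈⟨ +-congˡ (X-+ e (suc k ℕ.* e)) ⟩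
    X e * geom e (suc k) + X (suc (suc k) ℕ.* e) ∎

  geom-inverse : ∀ e .{{_ : NonZero e}} → (1# - X e) * geom e (suc N) ≈ 1#
  geom-inverse e = begin
    (1# - X e) * geom e (suc N)
      ≈⟨ distribʳ _ 1# (- X e) ⟩
    1# * geom e (suc N) + (- X e) * geom e (suc N)
      ≈⟨ +-cong (*-identityˡ _) (sym (-‿distribˡ-* (X e) _)) ⟩
    1# + X e * geom e N - X e * geom e (suc N)
      ≈⟨ +-congˡ (-‿cong (trans (X-*-geom e N) (+-congˡ (X-high N≤)))) ⟩
    1# + X e * geom e N - (X e * geom e N + 0#)
      ≈⟨ +-congˡ (-‿cong (+-identityʳ _)) ⟩
    1# + X e * geom e N - X e * geom e N
      ≈⟨ +-assoc 1# _ _ ⟩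
    1# + (X e * geom e N - X e * geom e N)
      ≈⟨ +-congˡ (-‿inverseʳ _) ⟩
    1# + 0#
      ≈⟨ +-identityʳ 1# ⟩
    1# ∎
    where
    N≤ : N ≤ suc N ℕ.* e
    N≤ = ℕₚ.≤-trans (ℕₚ.n≤1+n N) (ℕₚ.m≤m*n (suc N) e)

  -- Products and their inverses.

  InverseDominatesOne : Carrier → Set _
  InverseDominatesOne f = ∃[ M ] P M × f * (1# + M) ≈ 1#

  ∏ : ℕ → (ℕ → Carrier) → Carrier
  ∏ zero    f = 1#
  ∏ (suc k) f = ∏ k f * f k

  -- The witness is read off from `(1+M₁)(1+M₂) = 1 + (M₁ + (1+M₁) M₂)`. The `1` stays separate
  -- because `K` contains `M` itself.
  ∏-inverseDominatesOne : ∀ {f} → (∀ i → InverseDominatesOne (f i)) →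
                          ∀ k → InverseDominatesOne (∏ k f)
  ∏-inverseDominatesOne inv zero = 0# , P-0 , trans (*-identityˡ _) (+-identityʳ 1#)
  ∏-inverseDominatesOne {f} inv (suc k)
    with M₁ , 0≤M₁ , inv₁ ← ∏-inverseDominatesOne inv k
       | M₂ , 0≤M₂ , inv₂ ← inv k
    = M₁ + (1# + M₁) * M₂
    , P-+ 0≤M₁ (P-* (P-+ P-1 0≤M₁) 0≤M₂)
    , (begin
      ∏ k f * f k * (1# + (M₁ + (1# + M₁) * M₂))
        ≈⟨ *-congˡ (+-assoc 1# M₁ _) ⟨
      ∏ k f * f k * (1# + M₁ + (1# + M₁) * M₂)
        ≈⟨ *-congˡ (+-congʳ (*-identityʳ _)) ⟨
      ∏ k f * f k * ((1# + M₁) * 1# + (1# + M₁) * M₂)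
        ≈⟨ *-congˡ (distribˡ _ 1# M₂) ⟨
      ∏ k f * f k * ((1# + M₁) * (1# + M₂))
        ≈⟨ interchange _ _ _ _ ⟩
      (∏ k f * (1# + M₁)) * (f k * (1# + M₂))
        ≈⟨ *-cong inv₁ inv₂ ⟩
      1# * 1#
        ≈⟨ *-identityˡ 1# ⟩
      1# ∎)

  -- Covers both factors congruent to 1 (`w = 1`) and factors that become trivial only next to a
  -- high power of q.
  ∏-absorb : ∀ {w f} → (∀ i → w * f i ≈ w) → ∀ k → w * ∏ k f ≈ w
  ∏-absorb         absorb zero    = *-identityʳ _
  ∏-absorb {w} {f} absorb (suc k) = begin
    w * (∏ k f * f k)  ≈⟨ *-assoc w _ _ ⟨
    w * ∏ k f * f k    ≈⟨ *-congʳ (∏-absorb absorb k) ⟩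
    w * f k            ≈⟨ absorb k ⟩
    w                   ∎

  ∏-shift₂ : ∀ f k → ∏ (2 ℕ.+ k) f ≈ f 0 * f 1 * ∏ k (λ i → f (2 ℕ.+ i))
  ∏-shift₂ f zero    = trans (*-congʳ (*-identityˡ (f 0))) (sym (*-identityʳ _))
  ∏-shift₂ f (suc k) = trans (*-congʳ (∏-shift₂ f k)) (*-assoc _ _ _)

  -- Truncated q-Pochhammer products.

  module _ (z : Carrier) (m : ℕ) where

    factor : ℕ → Carrier
    factor i = 1# - z * X (m ℕ.* i)

    -- Two factors are to be split off, leaving `N`; the total exceeds every `n < N`, as
    -- `poch-limit` requires.
    poch : Carrier
    poch = ∏ (2 ℕ.+ N) factor

    pochTail : Carrier
    pochTail = ∏ N (λ i → factor (2 ℕ.+ i))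

    poch-split : poch ≈ (1# - z) * (1# - z * X m) * pochTail
    poch-split = begin
      poch
        ≈⟨ ∏-shift₂ factor N ⟩
      (1# - z * X (m ℕ.* 0)) * (1# - z * X (m ℕ.* 1)) * pochTail
        ≈⟨ *-congʳ (*-cong
             (+-congˡ (-‿cong (trans (*-congˡ (trans (X-cong (ℕₚ.*-zeroʳ m)) X-0)) (*-identityʳ z))))
             (+-congˡ (-‿cong (*-congˡ (X-cong (ℕₚ.*-identityʳ m)))))) ⟩
      (1# - z) * (1# - z * X m) * pochTail ∎

  -- From the third factor on, the exponents are at least `c + 2m`, hence at least `N`.
  pochTail≈1 : ∀ c m → N ≤ c ℕ.+ 2 ℕ.* m → pochTail (- X c) m ≈ 1#
  pochTail≈1 c m N≤ = trans (sym (*-identityˡ _))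
    (∏-absorb (λ i → trans (*-identityˡ _) (factor≈1 i)) N)
    where
    factor≈1 : ∀ i → factor (- X c) m (2 ℕ.+ i) ≈ 1#
    factor≈1 i = 1-0≈1 (begin
      (- X c) * X (m ℕ.* (2 ℕ.+ i))  ≈⟨ -‿distribˡ-* (X c) _ ⟨
      - (X c * X (m ℕ.* (2 ℕ.+ i)))  ≈⟨ -‿cong (X-+ c _) ⟩
      - X (c ℕ.+ m ℕ.* (2 ℕ.+ i))    ≈⟨ -‿cong (X-high (ℕₚ.≤-trans N≤ (ℕₚ.+-monoʳ-≤ c 2m≤))) ⟩
      - 0#                           ≈⟨ -0#≈0# ⟩
      0#                             ∎)
      where
      2m≤ : 2 ℕ.* m ≤ m ℕ.* (2 ℕ.+ i)
      2m≤ = ℕₚ.≤-trans (ℕₚ.*-monoˡ-≤ m (ℕₚ.m≤m+n 2 i)) (ℕₚ.≤-reflexive (ℕₚ.*-comm (2 ℕ.+ i) m))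

  poch-negative : ∀ c m → N ≤ c ℕ.+ 2 ℕ.* m →
    poch (- X c) m ≈ (1# + X c) * (1# + X c * X m)
  poch-negative c m N≤ = begin
    poch (- X c) m
      ≈⟨ poch-split (- X c) m ⟩
    (1# - (- X c)) * (1# - (- X c) * X m) * pochTail (- X c) m
      ≈⟨ trans (*-congˡ (pochTail≈1 c m N≤)) (*-identityʳ _) ⟩
    (1# - (- X c)) * (1# - (- X c) * X m)
      ≈⟨ *-cong (+-congˡ (-‿involutive _))
           (+-congˡ (trans (-‿cong (sym (-‿distribˡ-* _ _))) (-‿involutive _))) ⟩
    (1# + X c) * (1# + X c * X m) ∎

  -- The factors themselves may differ from 1 modulo q^N, but each deviation has exponent at least
  -- `m`, which lifts `X j` to exponent `N` or beyond. Used with `X j = xQ`.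
  pochTail-absorb : ∀ {j} b m → N ≤ j ℕ.+ m → X j * pochTail (X b) m ≈ X j
  pochTail-absorb {j} b m N≤ = ∏-absorb absorb N
    where
    high : ∀ i → N ≤ j ℕ.+ (b ℕ.+ m ℕ.* (2 ℕ.+ i))
    high i = ℕₚ.≤-trans N≤ (ℕₚ.+-monoʳ-≤ j
      (ℕₚ.≤-trans (ℕₚ.m≤m*n m (2 ℕ.+ i)) (ℕₚ.m≤n+m _ b)))
    absorb : ∀ i → X j * factor (X b) m (2 ℕ.+ i) ≈ X j
    absorb i = begin
      X j * (1# - X b * X (m ℕ.* (2 ℕ.+ i)))
        ≈⟨ distribˡ _ 1# _ ⟩
      X j * 1# + X j * (- (X b * X (m ℕ.* (2 ℕ.+ i))))
        ≈⟨ +-cong (*-identityʳ _) (sym (-‿distribʳ-* _ _)) ⟩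
      X j - X j * (X b * X (m ℕ.* (2 ℕ.+ i)))
        ≈⟨ +-congˡ (-‿cong (trans (*-congˡ (X-+ b _)) (trans (X-+ j _) (X-high (high i))))) ⟩
      X j - 0#
        ≈⟨ trans (+-congˡ -0#≈0#) (+-identityʳ _) ⟩
      X j ∎

  pochTail-inverse : ∀ b m .{{_ : NonZero b}} → InverseDominatesOne (pochTail (X b) m)
  pochTail-inverse b@(suc _) m = ∏-inverseDominatesOne
    -- `geom (e i) (suc N)` unfolds to `1# + X (e i) * geom (e i) N`, already of the form `1 + M`.
    (λ i → X (e i) * geom (e i) N
         , P-* (P-X (e i)) (P-geom (e i) N)
         , trans (*-congʳ (+-congˡ (-‿cong (X-+ b (m ℕ.* (2 ℕ.+ i)))))) (geom-inverse (e i)))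
    N
    where
    e : ℕ → ℕ
    e i = b ℕ.+ m ℕ.* (2 ℕ.+ i)

  -- Positivity of the quotient.

  P-K : ∀ {x y Q T u M} → P x → P y → P Q → P T → P u → P M → P (K x y Q T u M)
  P-K {x} {y} {Q} {T} 0≤x 0≤y 0≤Q 0≤T 0≤u 0≤M = P-+
      (P-+ 0≤A (P-* 0≤Q 0≤B))
      (P-* 0≤A (P-+ (P-* (P-* (P-* 0≤y 0≤Q) (P-* 0≤y 0≤Q)) 0≤u) (P-* 0≤u 0≤M)))
    where
    0≤xx : P (x * x)
    0≤xx = P-* 0≤x 0≤x
    0≤A : P (A x T)
    0≤A = P-+ (P-+ (P-+ P-1 0≤T) (P-* 0≤x 0≤T)) 0≤xx
    0≤B : P (B x y T)
    0≤B = P-+ (P-+ (P-+ 0≤T (P-* (P-* 0≤x 0≤y) 0≤T)) 0≤xx) (P-* (P-* 0≤xx 0≤x) 0≤y)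

  -- Nonnegativity of all coefficients is not invariant under congruence modulo q^N, so the
  -- conclusion provides a positive representative of `p * r`.
  quotient-positive : ∀ a b m .{{_ : NonZero a}} .{{_ : NonZero b}} → b ∣ a → N ≤ a ℕ.+ 2 ℕ.* m →
    ∀ {d p r} → d * r ≈ 1# → d ≈ poch (- X a) m * poch (X b) m → p ≈ poch (- X (a ℕ.+ b)) m →
    ∃[ f ] P f × p * r ≈ f
  quotient-positive a b m (divides zero a≡0) _ = contradiction a≡0 (ℕ.≢-nonZero⁻¹ a)
  quotient-positive a@(suc _) b@(suc _) m (divides (suc k) a≡) N≤ dr≈1 d≈ p≈
    with M , 0≤M , E-inv ← pochTail-inverse b m
    -- The representative is `g * K`, with `g` and `u` the truncated inverses of `1-x²` and `1-yQ`.
    -- As `a = (k+1) b`, the sum `1 + y + ... + y^k` is `(1-x)/(1-y)`, so `T` is `X b * geom b k`.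
    = _
    , P-* (P-geom (a ℕ.+ a) (suc N))
        (P-K (P-X a) (P-X b) (P-X m) (P-* (P-X b) (P-geom b k)) (P-geom (b ℕ.+ m) (suc N)) 0≤M)
    , quotient yS≈T+x g-inv u-inv E-inv xQQ≈0 xQE≈xQ dr≈1
        (trans d≈ (*-cong (poch-negative a m N≤) (poch-split (X b) m)))
        (trans p≈ (trans (poch-negative (a ℕ.+ b) m N≤a+b+2m)
          (*-cong (+-congˡ X-a+b) (+-congˡ (*-congʳ X-a+b)))))
    where
    N≤a+m+m : N ≤ a ℕ.+ m ℕ.+ m
    N≤a+m+m = ℕₚ.≤-trans N≤ (ℕₚ.≤-reflexive
      (≡-trans (cong (λ s → a ℕ.+ (m ℕ.+ s)) (ℕₚ.+-identityʳ m)) (≡-sym (ℕₚ.+-assoc a m m))))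

    N≤a+b+2m : N ≤ a ℕ.+ b ℕ.+ 2 ℕ.* m
    N≤a+b+2m = ℕₚ.≤-trans N≤ (ℕₚ.+-monoˡ-≤ (2 ℕ.* m) (ℕₚ.m≤m+n a b))

    X-a+b : X (a ℕ.+ b) ≈ X a * X b
    X-a+b = sym (X-+ a b)

    yS≈T+x : X b * (1# + X b * geom b k) ≈ X b * geom b k + X a
    yS≈T+x = trans (X-*-geom b k) (+-congˡ (X-cong (≡-sym a≡)))

    g-inv : (1# - X a * X a) * geom (a ℕ.+ a) (suc N) ≈ 1#
    g-inv = trans (*-congʳ (+-congˡ (-‿cong (X-+ a a)))) (geom-inverse (a ℕ.+ a))

    u-inv : (1# - X b * X m) * geom (b ℕ.+ m) (suc N) ≈ 1#
    u-inv = trans (*-congʳ (+-congˡ (-‿cong (X-+ b m)))) (geom-inverse (b ℕ.+ m))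

    xQQ≈0 : X a * X m * X m ≈ 0#
    xQQ≈0 = trans (*-congʳ (X-+ a m)) (trans (X-+ (a ℕ.+ m) m) (X-high N≤a+m+m))

    xQE≈xQ : X a * X m * pochTail (X b) m ≈ X a * X m
    xQE≈xQ = trans (*-congʳ (X-+ a m)) (trans (pochTail-absorb b m N≤a+m+m) (sym (X-+ a m)))

-- Transfer to the coefficients of `F`.

open import Data.Nat.Base using (_+_; _*_)

theorem1p7 : ∀ (a b m : ℕ) .{{_ : NonZero a}} .{{_ : NonZero b}} .{{_ : NonZero m}} →
    b ∣ a → ∀ (n : ℕ) → n < a + 2 * m → 0ℤ ℤ.≤ F a b m n
theorem1p7 a b m b∣a n n<N =
  let G , 0≤G , F≈G = quotient-positive a b m b∣a ℕₚ.≤-refl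
        (≗⇒≈ (⊗-recip D (F-denominator-constant a b m)))
        (*-cong (poch≈ (⊝ q^ a)) (poch≈ (q^ b)))
        (poch≈ (⊝ q^ (a + b)))
  -- `G` is nonnegative everywhere but agrees with `F` only below `N`, so the bound on `n` is used
  -- here.
  in subst (0ℤ ℤ.≤_) (≡-sym (coeff F≈G n<N)) (0≤G n)
  where
  N : ℕ
  N = a + 2 * m

  open Truncated N
  open CommutativeRing commutativeRing using (*-cong)
  open TruncatedProducts commutativeRing const-morphism nonNegativeMonomials

  D : FPS
  D = ⟨ ⊝ q^ a ⨾q^ m ⟩∞ ⊗ ⟨ q^ b ⨾q^ m ⟩∞

  -- Both products multiply on the right by the same recursion, so the abstract one specialises to
  -- the concrete one as an equality of series.
  ∏<≡∏ : ∀ k f → ∏< k f ≡ ∏ k f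
  ∏<≡∏ zero    f = ≡-refl
  ∏<≡∏ (suc k) f = cong (_⊗ f k) (∏<≡∏ k f)

  poch≈ : ∀ z → ⟨ z ⨾q^ m ⟩∞ ≈ poch z m
  poch≈ z = agree λ {n} n<N → ≡-trans
    (≡-sym (poch-limit z m n (2 + N) (ℕₚ.<-≤-trans n<N (ℕₚ.m≤n+m N 2))))
    (cong (λ f → f n) (∏<≡∏ (2 + N) (pochFactor z m)))
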